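{- Let $\theta=\phi(D)$ be a delta operator with poweroids $x^{\{r\}}$, and let $\eta=\phi^{ -1}(D)$. For every formal power series $f$ and every integer $r\ge0$, $$f(D)\,0^{\{r\}}=f(\eta)\,0^r.$$
   Context: Work with polynomials in $x$ (real or complex coefficients); $D=d/dx$. A delta operator is $\theta=\phi(D)$, where $\phi(t)=\sum_{\nu\ge1}k_\nu t^\nu$ is a formal power series with $k_1=1$; $\phi^{ -1}$ is its compositional inverse. The poweroids $x^{\{n\}}$, $n=0,1,2,\dots$, of $\theta$ are the unique polynomials with $x^{\{0\}}=1$, $\theta x^{\{n\}}=n\,x^{\{n-1\}}$ for $n\ge1$, and $x^{\{n\}}|_{x=0}=0$ for $n\ge1$. Notation: $f(D)\,0^{\{r\}}=\big(f(D)x^{\{r\}}\big)|_{x=0}$ and $f(\eta)\,0^r=\big(f(\phi^{ -1}(D))\,x^r\big)|_{x=0}$. -}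

module Defs where

open import Level using (_⊔_)
open import Algebra.Bundles using (CommutativeRing; Semiring)
open import Algebra.Apartness.Bundles using (HeytingField; HeytingCommutativeRing)
import Algebra.Definitions.RawSemiring as RawSemiringDefs
open import Data.Fin.Base using (toℕ)
open import Data.Nat.Base as ℕ using (ℕ; zero; suc; _∸_; _≤_; s≤s)
open import Data.Nat.GeneralisedArithmetic using (fold)
import Data.Nat.Properties as ℕₚ
import Data.Vec.Functional as Vector

-- The scalars form an arbitrary field (taken of characteristic zero, see below);
-- ℝ and ℂ are the cases of interest.
module Operators {c ℓ₁ ℓ₂} (K : HeytingField c ℓ₁ ℓ₂) where

  open HeytingField K using (_#_; heytingCommutativeRing)
  open HeytingCommutativeRing heytingCommutativeRing using (commutativeRing)
  open CommutativeRing commutativeRing public hiding (_-_)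
  open RawSemiringDefs (Semiring.rawSemiring semiring) public
    using (_×_; _^_; sum)

  CharacteristicZero : Set ℓ₂
  CharacteristicZero = ∀ n → (suc n × 1#) # 0#

  kronecker : ℕ → ℕ → Carrier
  kronecker zero    zero    = 1#
  kronecker zero    (suc n) = 0#
  kronecker (suc m) zero    = 0#
  kronecker (suc m) (suc n) = kronecker m n

  infix 4 _≈ₚ_
  infixl 6 _+ₚ_
  infixr 7 _·ₚ_

  -- All coefficients from index `bound` on vanish; `bound` need not be least,
  -- and _≈ₚ_ ignores it.
  record Poly : Set (c ⊔ ℓ₁) where
    field
      coeff    : ℕ → Carrier
      bound    : ℕ
      vanishes : ∀ {n} → bound ≤ n → coeff n ≈ 0#

  open Poly public

  _≈ₚ_ : Poly → Poly → Set ℓ₁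
  p ≈ₚ q = ∀ n → coeff p n ≈ coeff q n

  0ₚ : Poly
  0ₚ = record { coeff = λ _ → 0# ; bound = 0 ; vanishes = λ _ → refl }

  _+ₚ_ : Poly → Poly → Poly
  p +ₚ q = record
    { coeff    = λ n → coeff p n + coeff q n
    ; bound    = bound p ℕ.⊔ bound q
    ; vanishes = λ b≤n → trans
        (+-cong (vanishes p (ℕₚ.m⊔n≤o⇒m≤o (bound p) (bound q) b≤n))
                (vanishes q (ℕₚ.m⊔n≤o⇒n≤o (bound p) (bound q) b≤n)))
        (+-identityˡ 0#)
    }

  _·ₚ_ : Carrier → Poly → Poly
  a ·ₚ p = record
    { coeff    = λ n → a * coeff p n
    ; bound    = bound p
    ; vanishes = λ b≤n → trans (*-congˡ (vanishes p b≤n)) (zeroʳ a)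
    }

  X^_ : ℕ → Poly
  X^ r = record
    { coeff    = kronecker r
    ; bound    = suc r
    ; vanishes = kronecker-> r
    }
    where
    kronecker-> : ∀ r {n} → suc r ≤ n → kronecker r n ≈ 0#
    kronecker-> zero    (s≤s _)   = refl
    kronecker-> (suc r) (s≤s r<n) = kronecker-> r r<n

  sumₚ : ∀ {n} → Vector.Vector Poly n → Poly
  sumₚ = Vector.foldr _+ₚ_ 0ₚ

  eval : Poly → Carrier → Carrier
  eval p a = sum {bound p} (λ i → coeff p (toℕ i) * a ^ toℕ i)

  D : Poly → Poly
  D p = record
    { coeff    = λ n → (suc n × 1#) * coeff p (suc n)
    ; bound    = bound p ∸ 1
    ; vanishes = λ b≤n → trans
        (*-congˡ (vanishes p (ℕₚ.≤-trans (ℕₚ.m≤n+m∸n (bound p) 1) (s≤s b≤n))))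
        (zeroʳ _)
    }

  Series : Set c
  Series = ℕ → Carrier

  infix 4 _≈ₛ_
  infixl 7 _*ₛ_
  infixr 8 _^ₛ_
  infixr 9 _∘ₛ_

  _≈ₛ_ : Series → Series → Set ℓ₁
  f ≈ₛ g = ∀ n → f n ≈ g n

  t : Series
  t = kronecker 1

  _*ₛ_ : Series → Series → Series
  (f *ₛ g) n = sum {suc n} (λ i → f (toℕ i) * g (n ∸ toℕ i))

  _^ₛ_ : Series → ℕ → Series
  g ^ₛ zero  = kronecker 0
  g ^ₛ suc k = g *ₛ (g ^ₛ k)

  -- Meaningful only when g has zero constant term: then g ^ₛ k contributes
  -- nothing to the coefficient of t^n for k > n.
  _∘ₛ_ : Series → Series → Series
  (f ∘ₛ g) n = sum {suc n} (λ k → f (toℕ k) * (g ^ₛ toℕ k) n)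

  record IsDeltaSeries (φ : Series) : Set ℓ₁ where
    field
      constant≈0 : φ 0 ≈ 0#
      linear≈1   : φ 1 ≈ 1#

  record IsCompositionalInverse (φ ψ : Series) : Set ℓ₁ where
    field
      constant≈0 : ψ 0 ≈ 0#
      inverseˡ   : ψ ∘ₛ φ ≈ₛ t
      inverseʳ   : φ ∘ₛ ψ ≈ₛ t

  Operator : Set (c ⊔ ℓ₁)
  Operator = Poly → Poly

  -- f ⟨ T ⟩ = Σₖ fₖ Tᵏ, for a linear operator T that lowers degrees (such as D
  -- or φ ⟨ D ⟩ with φ 0 ≈ 0#): the terms with k ≥ bound p annihilate p, so
  -- stopping there loses nothing.
  infix 10 _⟨_⟩
  _⟨_⟩ : Series → Operator → Operator
  (f ⟨ T ⟩) p = sumₚ {bound p} (λ k → f (toℕ k) ·ₚ fold p T (toℕ k))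

  record IsPoweroids (θ : Operator) (x^[_] : ℕ → Poly) : Set ℓ₁ where
    field
      zeroth : x^[ 0 ] ≈ₚ X^ 0
      lower  : ∀ n → θ x^[ suc n ] ≈ₚ (suc n × 1#) ·ₚ x^[ n ]
      at-0   : ∀ n → eval x^[ suc n ] 0# ≈ 0#

{-# OPTIONS --safe #-}

-- Let L be the linear map with L xʳ = x^{r}. Since D xʳ = r xʳ⁻¹ and θ x^{r} = r x^{r-1},
-- L D = θ L, whence L η = L ψ(D) = ψ(θ) L = (ψ ∘ φ)(D) L = D L. Moreover L preserves the
-- value at 0, because x^{0} = 1 and the other poweroids vanish there. Therefore
-- (Dᵏ x^{r})(0) = (L ηᵏ xʳ)(0) = (ηᵏ xʳ)(0) for every k, and the theorem follows by linearity.
module Submission where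

open import Algebra.Apartness.Bundles using (HeytingField)
open import Algebra.Bundles using (CommutativeMonoid)
open import Algebra.Module.Bundles using (LeftSemimodule)
import Algebra.Properties.CommutativeMonoid.Sum as MonoidSum
import Algebra.Properties.Semiring.Sum as SemiringSum
open import Data.Fin.Base as Fin using (toℕ)
open import Data.Fin.Properties using (toℕ<n)
open import Data.Nat.Base as ℕ using (ℕ; zero; suc; _∸_; _≤_; _<_; z≤n; s≤s)
open import Data.Nat.GeneralisedArithmetic using (fold)
import Data.Nat.Properties as ℕₚ
open import Data.Product.Base using (_,_)
open import Data.Vec.Functional using (Vector)
open import Function.Base using (_∘_)
open import Level using (_⊔_)
import Relation.Binary.PropositionalEquality.Core as ≡
import Relation.Binary.Reasoning.Setoid as SetoidReasoning
open import Defs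

-- Finite sums over initial segments of the natural numbers.

module InitialSums {a ℓ} (M : CommutativeMonoid a ℓ) where

  open CommutativeMonoid M
  open MonoidSum M

  sum-ε : ∀ {n} {v : Vector Carrier n} → (∀ i → v i ≈ ε) → sum v ≈ ε
  sum-ε {n} v≈ε = trans (sum-cong-≋ v≈ε) (sum-replicate-zero n)

  -- Operators and evaluations below are sums cut off at a bound that depends on the argument. This
  -- moves two such sums to a common cut-off, where they can be compared term by term.
  sum-extend : ∀ (F : ℕ → Carrier) {m n} → m ≤ n → (∀ {k} → m ≤ k → F k ≈ ε) →
               sum {m} (F ∘ toℕ) ≈ sum {n} (F ∘ toℕ)
  sum-extend F {n = n} z≤n F≈ε = sym (sum-ε {n} λ i → F≈ε z≤n)
  sum-extend F (s≤s m≤n)   F≈ε = ∙-congˡ (sum-extend (F ∘ suc) m≤n (F≈ε ∘ s≤s))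

fold-comm : ∀ {a} {A : Set a} (z : A) (s : A → A) n → fold (s z) s n ≡.≡ s (fold z s n)
fold-comm z s zero    = ≡.refl
fold-comm z s (suc n) = ≡.cong s (fold-comm z s n)

module OverField {c ℓ₁ ℓ₂} (K : HeytingField c ℓ₁ ℓ₂) where

  open Operators K
  open SemiringSum semiring using (sum-cong-≋)
  open InitialSums +-commutativeMonoid using (sum-ε; sum-extend)

  -- Scalars and the order of powers of a series.

  x*[y*z]≈y*[x*z] : ∀ x y z → x * (y * z) ≈ y * (x * z)
  x*[y*z]≈y*[x*z] x y z =
    trans (sym (*-assoc x y z)) (trans (*-congʳ (*-comm x y)) (*-assoc y x z))

  -- Induction on `k`. In the coefficient of `g *ₛ (g ^ₛ k)` the term containing `g 0` is zero, and
  -- every other term uses a coefficient of `g ^ₛ k` of index below `k`.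
  ^ₛ-order : ∀ g → g 0 ≈ 0# → ∀ k {n} → n < k → (g ^ₛ k) n ≈ 0#
  ^ₛ-order g g0≈0 (suc k) {n} (s≤s n≤k) = trans
    (+-cong (trans (*-congʳ g0≈0) (zeroˡ _)) (rest n n≤k)) (+-identityˡ 0#)
    where
    rest : ∀ n → n ≤ k → sum {n} (λ i → g (suc (toℕ i)) * (g ^ₛ k) (n ∸ suc (toℕ i))) ≈ 0#
    rest zero    _   = refl
    rest (suc m) m<k = sum-ε {suc m} λ i → trans
      (*-congˡ (^ₛ-order g g0≈0 k (ℕₚ.≤-<-trans (ℕₚ.m∸n≤m m (toℕ i)) m<k)))
      (zeroʳ (g (suc (toℕ i))))

  -- Linear maps on a semimodule.

  module Linear {m ℓm} (V : LeftSemimodule semiring m ℓm) where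

    open LeftSemimodule V
    open MonoidSum +ᴹ-commutativeMonoid using ()
      renaming ( sum to sumᴹ; sum-cong-≋ to sumᴹ-cong; ∑-distrib-+ to sumᴹ-+
               ; ∑-comm to sumᴹ-comm )
    open InitialSums +ᴹ-commutativeMonoid using () renaming (sum-extend to sumᴹ-extend)

    *ₗ-distribʳ-sum : ∀ {n} (a : Vector Carrier n) v → sum a *ₗ v ≈ᴹ sumᴹ (λ i → a i *ₗ v)
    *ₗ-distribʳ-sum {zero}  a v = *ₗ-zeroˡ v
    *ₗ-distribʳ-sum {suc n} a v =
      ≈ᴹ-trans (*ₗ-distribʳ v _ _) (+ᴹ-congˡ (*ₗ-distribʳ-sum (a ∘ Fin.suc) v))

    -- The length `suc r` is the `bound` of `X^ r`, so this computes the value of a linear extension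
    -- at a monomial. The cases 0 and 1 also give the series 1 and `t` in an operator.
    sum-kronecker : ∀ r (F : ℕ → Carrierᴹ) →
                    sumᴹ {suc r} (λ i → kronecker r (toℕ i) *ₗ F (toℕ i)) ≈ᴹ F r
    sum-kronecker zero    F = ≈ᴹ-trans (+ᴹ-identityʳ _) (*ₗ-identityˡ (F 0))
    sum-kronecker (suc r) F = ≈ᴹ-trans
      (+ᴹ-cong (*ₗ-zeroˡ (F 0)) (sum-kronecker r (F ∘ suc))) (+ᴹ-identityˡ _)

    record IsLinear (T : Carrierᴹ → Carrierᴹ) : Set (c ⊔ m ⊔ ℓm) where
      field
        cong   : ∀ {u v} → u ≈ᴹ v → T u ≈ᴹ T v
        +-homo : ∀ u v → T (u +ᴹ v) ≈ᴹ T u +ᴹ T v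
        *-homo : ∀ a v → T (a *ₗ v) ≈ᴹ a *ₗ T v

      0-homo : T 0ᴹ ≈ᴹ 0ᴹ
      0-homo = ≈ᴹ-trans (cong (≈ᴹ-sym (*ₗ-zeroˡ 0ᴹ)))
        (≈ᴹ-trans (*-homo 0# 0ᴹ) (*ₗ-zeroˡ (T 0ᴹ)))

      sum-homo : ∀ {n} (v : Vector Carrierᴹ n) → T (sumᴹ v) ≈ᴹ sumᴹ (T ∘ v)
      sum-homo {zero}  v = 0-homo
      sum-homo {suc n} v = ≈ᴹ-trans (+-homo _ _) (+ᴹ-congˡ (sum-homo (v ∘ Fin.suc)))

    open IsLinear

    ∘-linear : ∀ {S T} → IsLinear S → IsLinear T → IsLinear (S ∘ T)
    ∘-linear S T = record
      { cong   = cong S ∘ cong T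
      ; +-homo = λ u v → ≈ᴹ-trans (cong S (+-homo T u v)) (+-homo S _ _)
      ; *-homo = λ a v → ≈ᴹ-trans (cong S (*-homo T a v)) (*-homo S _ _)
      }

    *ₗ-linear : ∀ a → IsLinear (a *ₗ_)
    *ₗ-linear a = record
      { cong   = *ₗ-congˡ
      ; +-homo = *ₗ-distribˡ a
      ; *-homo = λ b v → ≈ᴹ-trans (≈ᴹ-sym (*ₗ-assoc a b v))
          (≈ᴹ-trans (*ₗ-congʳ (*-comm a b)) (*ₗ-assoc b a v))
      }

    fold-linear : ∀ {T} → IsLinear T → ∀ k → IsLinear (λ v → fold v T k)
    fold-linear T zero = record
      { cong = λ e → e ; +-homo = λ u v → ≈ᴹ-refl ; *-homo = λ a v → ≈ᴹ-refl }
    fold-linear T (suc k) = ∘-linear T (fold-linear T k)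

    -- Sums of linear maps with an argument-dependent cut-off.

    module BoundedSum
      (bound′ : Carrierᴹ → ℕ)
      (G : ℕ → Carrierᴹ → Carrierᴹ)
      (G-linear : ∀ k → IsLinear (G k))
      (G-vanishes : ∀ v {k} → bound′ v ≤ k → G k v ≈ᴹ 0ᴹ)
      where

      total : Carrierᴹ → Carrierᴹ
      total v = sumᴹ {bound′ v} (λ k → G (toℕ k) v)

      extend : ∀ v {N} → bound′ v ≤ N → total v ≈ᴹ sumᴹ {N} (λ k → G (toℕ k) v)
      extend v b≤N = sumᴹ-extend (λ k → G k v) b≤N (G-vanishes v)

      -- `bound′` need not respect `≈ᴹ` or be related to the operations. Each law is therefore
      -- proved after extending all sums involved to the maximum of their bounds, where it holds
      -- term by term.
      total-linear : IsLinear total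
      total-linear = record
        { cong   = λ {u} {v} u≈v → let b₁ = bound′ u ; b₂ = bound′ v in
            ≈ᴹ-trans (extend u (ℕₚ.m≤m⊔n b₁ b₂))
              (≈ᴹ-trans (sumᴹ-cong {b₁ ℕ.⊔ b₂} λ i → cong (G-linear (toℕ i)) u≈v)
                (≈ᴹ-sym (extend v (ℕₚ.m≤n⊔m b₁ b₂))))
        ; +-homo = λ u v →
            let b₀ = bound′ (u +ᴹ v) ; b₁ = bound′ u ; b₂ = bound′ v
                N = b₀ ℕ.⊔ (b₁ ℕ.⊔ b₂) ; b₁⊔b₂≤N = ℕₚ.m≤n⊔m b₀ (b₁ ℕ.⊔ b₂)
            in ≈ᴹ-trans (extend (u +ᴹ v) (ℕₚ.m≤m⊔n b₀ (b₁ ℕ.⊔ b₂)))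
              (≈ᴹ-trans (sumᴹ-cong {N} λ i → +-homo (G-linear (toℕ i)) u v)
                (≈ᴹ-trans (sumᴹ-+ {N} (λ i → G (toℕ i) u) (λ i → G (toℕ i) v))
                  (≈ᴹ-sym (+ᴹ-cong (extend u (ℕₚ.m⊔n≤o⇒m≤o b₁ b₂ b₁⊔b₂≤N))
                                   (extend v (ℕₚ.m⊔n≤o⇒n≤o b₁ b₂ b₁⊔b₂≤N))))))
        ; *-homo = λ a v → let b₁ = bound′ (a *ₗ v) ; b₂ = bound′ v in
            ≈ᴹ-trans (extend (a *ₗ v) (ℕₚ.m≤m⊔n b₁ b₂))
              (≈ᴹ-trans (sumᴹ-cong {b₁ ℕ.⊔ b₂} λ i → *-homo (G-linear (toℕ i)) a v)
                (≈ᴹ-trans (≈ᴹ-sym (sum-homo (*ₗ-linear a) {b₁ ℕ.⊔ b₂} λ i → G (toℕ i) v))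
                  (*ₗ-congˡ (≈ᴹ-sym (extend v (ℕₚ.m≤n⊔m b₁ b₂))))))
        }

    -- Linear extension from prescribed images of the coordinate vectors.

    module BasisExtension
      (bound′ : Carrierᴹ → ℕ)
      (coord : ℕ → Carrierᴹ → Carrier)
      (coord-cong : ∀ i {u v} → u ≈ᴹ v → coord i u ≈ coord i v)
      (coord-+ : ∀ i u v → coord i (u +ᴹ v) ≈ coord i u + coord i v)
      (coord-* : ∀ i a v → coord i (a *ₗ v) ≈ a * coord i v)
      (coord-vanishes : ∀ v {i} → bound′ v ≤ i → coord i v ≈ 0#)
      (e : ℕ → Carrierᴹ)
      where

      component-linear : ∀ i → IsLinear (λ v → coord i v *ₗ e i)
      component-linear i = record
        { cong   = λ u≈v → *ₗ-congʳ (coord-cong i u≈v)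
        ; +-homo = λ u v → ≈ᴹ-trans (*ₗ-congʳ (coord-+ i u v)) (*ₗ-distribʳ (e i) _ _)
        ; *-homo = λ a v → ≈ᴹ-trans (*ₗ-congʳ (coord-* i a v)) (*ₗ-assoc a _ (e i))
        }

      open BoundedSum bound′ (λ i v → coord i v *ₗ e i) component-linear
        (λ v {i} b≤i → ≈ᴹ-trans (*ₗ-congʳ (coord-vanishes v b≤i)) (*ₗ-zeroˡ (e i)))
        public

      -- `S` is a weighted backward shift on coordinates, and `T` is the backward shift with the
      -- same weights on the vectors `e i`. Reindexing the sum by one matches the two. For `S` = `D`
      -- and `T` = `θ` the weights are the positive integers.
      total-shift : ∀ {S T : Carrierᴹ → Carrierᴹ} → IsLinear T → (a : ℕ → Carrier) →
                    (∀ i v → coord i (S v) ≈ a i * coord (suc i) v) →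
                    T (e 0) ≈ᴹ 0ᴹ → (∀ i → T (e (suc i)) ≈ᴹ a i *ₗ e i) →
                    ∀ v → total (S v) ≈ᴹ T (total v)
      total-shift {S} {T} T-linear a coord-S T-e₀ T-e v = ≈ᴹ-sym (begin
        T (total v)
          -- Length `suc N`: the term of index 0 is killed by `T`, and the `N` terms left over must
          -- cover all of `S v`.
          ≈⟨ cong T-linear (extend v (ℕₚ.m≤n⇒m≤1+n (ℕₚ.m≤m⊔n (bound′ v) (bound′ (S v))))) ⟩
        T (sumᴹ {suc N} (λ i → coord (toℕ i) v *ₗ e (toℕ i)))
          ≈⟨ sum-homo T-linear {suc N} (λ i → coord (toℕ i) v *ₗ e (toℕ i)) ⟩
        T (coord 0 v *ₗ e 0) +ᴹ sumᴹ {N} (λ i → T (coord (suc (toℕ i)) v *ₗ e (suc (toℕ i))))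
          ≈⟨ +ᴹ-cong
               (≈ᴹ-trans (*-homo T-linear _ _) (≈ᴹ-trans (*ₗ-congˡ T-e₀) (*ₗ-zeroʳ _)))
               (sumᴹ-cong {N} λ i → T-term (toℕ i)) ⟩
        0ᴹ +ᴹ sumᴹ {N} (λ i → coord (toℕ i) (S v) *ₗ e (toℕ i))
          ≈⟨ +ᴹ-identityˡ _ ⟩
        sumᴹ {N} (λ i → coord (toℕ i) (S v) *ₗ e (toℕ i))
          ≈⟨ extend (S v) (ℕₚ.m≤n⊔m (bound′ v) (bound′ (S v))) ⟨
        total (S v) ∎)
        where
        open SetoidReasoning ≈ᴹ-setoid
        N = bound′ v ℕ.⊔ bound′ (S v)
        T-term : ∀ i → T (coord (suc i) v *ₗ e (suc i)) ≈ᴹ coord i (S v) *ₗ e i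
        T-term i = begin
          T (coord (suc i) v *ₗ e (suc i))   ≈⟨ *-homo T-linear _ _ ⟩
          coord (suc i) v *ₗ T (e (suc i))   ≈⟨ *ₗ-congˡ (T-e i) ⟩
          coord (suc i) v *ₗ a i *ₗ e i      ≈⟨ *ₗ-assoc _ _ _ ⟨
          (coord (suc i) v * a i) *ₗ e i     ≈⟨ *ₗ-congʳ (*-comm _ _) ⟩
          (a i * coord (suc i) v) *ₗ e i     ≈⟨ *ₗ-congʳ (coord-S i v) ⟨
          coord i (S v) *ₗ e i               ∎

    -- Power series in a locally nilpotent operator.

    module LocallyNilpotent
      (T : Carrierᴹ → Carrierᴹ)
      (T-linear : IsLinear T)
      (bound′ : Carrierᴹ → ℕ)
      (T-nilpotent : ∀ v {k} → bound′ v ≤ k → fold v T k ≈ᴹ 0ᴹ)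
      where

      open SetoidReasoning ≈ᴹ-setoid

      -- A cut-off independent of `v` permits induction on its length; `⟦ f ⟧ v` is the case `N` =
      -- `bound′ v`.
      truncated : ℕ → Series → Carrierᴹ → Carrierᴹ
      truncated N f v = sumᴹ {N} (λ k → f (toℕ k) *ₗ fold v T (toℕ k))

      module _ (f : Series) where
        open BoundedSum bound′ (λ k v → f k *ₗ fold v T k)
          (λ k → ∘-linear (*ₗ-linear (f k)) (fold-linear T-linear k))
          (λ v {k} b≤k → ≈ᴹ-trans (*ₗ-congˡ (T-nilpotent v b≤k)) (*ₗ-zeroʳ (f k)))
          public renaming (total to ⟦_⟧; extend to ⟦⟧-extend; total-linear to ⟦⟧-linear)

      truncated-congˡ : ∀ N {f g} → f ≈ₛ g → ∀ v → truncated N f v ≈ᴹ truncated N g v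
      truncated-congˡ N f≈g v = sumᴹ-cong {N} λ i → *ₗ-congʳ (f≈g (toℕ i))

      truncated-cong : ∀ N f {u v} → u ≈ᴹ v → truncated N f u ≈ᴹ truncated N f v
      truncated-cong N f u≈v =
        sumᴹ-cong {N} λ i → *ₗ-congˡ (cong (fold-linear T-linear (toℕ i)) u≈v)

      truncated-extend : ∀ f v {M N} → M ≤ N → (∀ {k} → M ≤ k → fold v T k ≈ᴹ 0ᴹ) →
                         truncated M f v ≈ᴹ truncated N f v
      truncated-extend f v M≤N Tᵏv≈0 = sumᴹ-extend (λ k → f k *ₗ fold v T k) M≤N
        λ {k} M≤k → ≈ᴹ-trans (*ₗ-congˡ (Tᵏv≈0 M≤k)) (*ₗ-zeroʳ (f k))

      truncated-+ : ∀ N f g v →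
                    truncated N (λ n → f n + g n) v ≈ᴹ truncated N f v +ᴹ truncated N g v
      truncated-+ N f g v = ≈ᴹ-trans
        (sumᴹ-cong {N} λ i → *ₗ-distribʳ (fold v T (toℕ i)) (f (toℕ i)) (g (toℕ i)))
        (sumᴹ-+ {N} _ _)

      truncated-* : ∀ N a f v → truncated N (λ n → a * f n) v ≈ᴹ a *ₗ truncated N f v
      truncated-* N a f v = ≈ᴹ-trans
        (sumᴹ-cong {N} λ i → *ₗ-assoc a (f (toℕ i)) (fold v T (toℕ i)))
        (≈ᴹ-sym (sum-homo (*ₗ-linear a) {N} _))

      truncated-suc : ∀ N f v →
                      truncated (suc N) f v ≈ᴹ f 0 *ₗ v +ᴹ truncated N (f ∘ suc) (T v)
      truncated-suc N f v = +ᴹ-congˡ (sumᴹ-cong {N} λ i →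
        *ₗ-congˡ (≈ᴹ-reflexive (≡.sym (fold-comm v T (toℕ i)))))

      truncated-comm : ∀ N f v → T (truncated N f v) ≈ᴹ truncated N f (T v)
      truncated-comm N f v = ≈ᴹ-trans (sum-homo T-linear {N} _)
        (sumᴹ-cong {N} λ i → ≈ᴹ-trans (*-homo T-linear (f (toℕ i)) _)
          (*ₗ-congˡ (≈ᴹ-reflexive (≡.sym (fold-comm v T (toℕ i))))))

      -- Induction on `N`, splitting off the constant term of `f`: the Cauchy product unfolds to
      -- `f 0` times `g` plus the shifted product of `f ∘ suc` with `g`. Nilpotency is what removes
      -- the products of total degree `N` or more, which occur only on the right.
      truncated-*ₛ : ∀ N f g v → (∀ {k} → N ≤ k → fold v T k ≈ᴹ 0ᴹ) →
                     truncated N (f *ₛ g) v ≈ᴹ truncated N f (truncated N g v)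
      truncated-*ₛ zero    f g v _    = ≈ᴹ-refl
      truncated-*ₛ (suc N) f g v Tᵏv≈0 = begin
        truncated (suc N) (f *ₛ g) v
          ≈⟨ truncated-suc N (f *ₛ g) v ⟩
        (f 0 * g 0 + 0#) *ₗ v +ᴹ
          truncated N (λ n → f 0 * g (suc n) + ((f ∘ suc) *ₛ g) n) (T v)
          ≈⟨ +ᴹ-cong (≈ᴹ-trans (*ₗ-congʳ (+-identityʳ _)) (*ₗ-assoc _ _ v))
               (truncated-+ N (λ n → f 0 * g (suc n)) ((f ∘ suc) *ₛ g) (T v)) ⟩
        f 0 *ₗ g 0 *ₗ v +ᴹ
          (truncated N (λ n → f 0 * g (suc n)) (T v) +ᴹ truncated N ((f ∘ suc) *ₛ g) (T v))
          ≈⟨ +ᴹ-congˡ (+ᴹ-cong (truncated-* N (f 0) (g ∘ suc) (T v))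
               (truncated-*ₛ N (f ∘ suc) g (T v) Tᵏ⁺¹v≈0)) ⟩
        f 0 *ₗ g 0 *ₗ v +ᴹ
          (f 0 *ₗ truncated N (g ∘ suc) (T v) +ᴹ truncated N (f ∘ suc) (truncated N g (T v)))
          ≈⟨ +ᴹ-assoc _ _ _ ⟨
        (f 0 *ₗ g 0 *ₗ v +ᴹ f 0 *ₗ truncated N (g ∘ suc) (T v)) +ᴹ
          truncated N (f ∘ suc) (truncated N g (T v))
          ≈⟨ +ᴹ-cong
               (≈ᴹ-trans (*ₗ-congˡ (truncated-suc N g v)) (*ₗ-distribˡ (f 0) _ _))
               -- `T` moves inside the longer sum; its last term then carries the power `suc N` of
               -- `T` on `v`, which is zero, so length `N` suffices.
               (truncated-cong N (f ∘ suc) (≈ᴹ-trans (truncated-comm (suc N) g v)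
                 (≈ᴹ-sym (truncated-extend g (T v) (ℕₚ.n≤1+n N) Tᵏ⁺¹v≈0)))) ⟨
        f 0 *ₗ truncated (suc N) g v +ᴹ truncated N (f ∘ suc) (T (truncated (suc N) g v))
          ≈⟨ truncated-suc N f (truncated (suc N) g v) ⟨
        truncated (suc N) f (truncated (suc N) g v) ∎
        where
        Tᵏ⁺¹v≈0 : ∀ {k} → N ≤ k → fold (T v) T k ≈ᴹ 0ᴹ
        Tᵏ⁺¹v≈0 {k} N≤k = ≈ᴹ-trans (≈ᴹ-reflexive (fold-comm v T k)) (Tᵏv≈0 (s≤s N≤k))

      ⟦⟧-*ₛ : ∀ f g v → ⟦ f *ₛ g ⟧ v ≈ᴹ ⟦ f ⟧ (⟦ g ⟧ v)
      ⟦⟧-*ₛ f g v = begin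
        ⟦ f *ₛ g ⟧ v                        ≈⟨ ⟦⟧-extend (f *ₛ g) v b₁≤N ⟩
        truncated N (f *ₛ g) v              ≈⟨ truncated-*ₛ N f g v (T-nilpotent v ∘ ℕₚ.≤-trans b₁≤N) ⟩
        truncated N f (truncated N g v)     ≈⟨ truncated-cong N f (⟦⟧-extend g v b₁≤N) ⟨
        truncated N f (⟦ g ⟧ v)             ≈⟨ ⟦⟧-extend f (⟦ g ⟧ v) (ℕₚ.m≤n⊔m (bound′ v) _) ⟨
        ⟦ f ⟧ (⟦ g ⟧ v)                     ∎
        where
        N = bound′ v ℕ.⊔ bound′ (⟦ g ⟧ v)
        b₁≤N = ℕₚ.m≤m⊔n (bound′ v) (bound′ (⟦ g ⟧ v))

      ⟦1⟧ : ∀ v → ⟦ kronecker 0 ⟧ v ≈ᴹ v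
      ⟦1⟧ v = begin
        ⟦ kronecker 0 ⟧ v
          -- `bound′ v` may be zero, so the sum is lengthened first and only then cut back to its
          -- single nonzero coefficient.
          ≈⟨ ⟦⟧-extend (kronecker 0) v (ℕₚ.n≤1+n (bound′ v)) ⟩
        truncated (suc (bound′ v)) (kronecker 0) v
          ≈⟨ sumᴹ-extend (λ k → kronecker 0 k *ₗ fold v T k) {1} {suc (bound′ v)} (s≤s z≤n)
               (λ { (s≤s _) → *ₗ-zeroˡ _ }) ⟨
        truncated 1 (kronecker 0) v
          ≈⟨ sum-kronecker 0 (fold v T) ⟩
        v ∎

      ⟦t⟧ : ∀ v → ⟦ t ⟧ v ≈ᴹ T v
      ⟦t⟧ v = begin
        ⟦ t ⟧ v
          ≈⟨ ⟦⟧-extend t v (ℕₚ.m≤n+m (bound′ v) 2) ⟩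
        truncated (2 ℕ.+ bound′ v) t v
          ≈⟨ sumᴹ-extend (λ k → t k *ₗ fold v T k) {2} {2 ℕ.+ bound′ v} (s≤s (s≤s z≤n))
               (λ { (s≤s (s≤s _)) → *ₗ-zeroˡ _ }) ⟨
        truncated 2 t v
          ≈⟨ sum-kronecker 1 (fold v T) ⟩
        T v ∎

      ⟦⟧-^ₛ : ∀ g k v → ⟦ g ^ₛ k ⟧ v ≈ᴹ fold v ⟦ g ⟧ k
      ⟦⟧-^ₛ g zero    v = ⟦1⟧ v
      ⟦⟧-^ₛ g (suc k) v =
        ≈ᴹ-trans (⟦⟧-*ₛ g (g ^ₛ k) v) (cong (⟦⟧-linear g) (⟦⟧-^ₛ g k v))

      -- Substitution of series is substitution of operators. Since `g ^ₛ k` begins no earlier than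
      -- degree `k`, the triangular double sum can be filled up to an `N` by `N` square, and the
      -- order of summation exchanged.
      ⟦⟧-∘ₛ : ∀ f g → g 0 ≈ 0# → ∀ v {N} → bound′ v ≤ N →
              ⟦ f ∘ₛ g ⟧ v ≈ᴹ sumᴹ {N} (λ k → f (toℕ k) *ₗ fold v ⟦ g ⟧ (toℕ k))
      ⟦⟧-∘ₛ f g g0≈0 v {N} b≤N = begin
        ⟦ f ∘ₛ g ⟧ v
          ≈⟨ ⟦⟧-extend (f ∘ₛ g) v b≤N ⟩
        sumᴹ {N} (λ n → (f ∘ₛ g) (toℕ n) *ₗ fold v T (toℕ n))
          ≈⟨ sumᴹ-cong {N} (λ n → *ₗ-congʳ (sum-extend (λ k → f k * (g ^ₛ k) (toℕ n)) (toℕ<n n)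
               (λ {k} n<k → trans (*-congˡ (^ₛ-order g g0≈0 k n<k)) (zeroʳ _)))) ⟩
        sumᴹ {N} (λ n → sum {N} (λ k → f (toℕ k) * (g ^ₛ toℕ k) (toℕ n)) *ₗ fold v T (toℕ n))
          ≈⟨ sumᴹ-cong {N} (λ n → *ₗ-distribʳ-sum {N} _ (fold v T (toℕ n))) ⟩
        sumᴹ {N} (λ n → sumᴹ {N} (λ k → (f (toℕ k) * (g ^ₛ toℕ k) (toℕ n)) *ₗ fold v T (toℕ n)))
          ≈⟨ sumᴹ-comm {N} {N} (λ n k → (f (toℕ k) * (g ^ₛ toℕ k) (toℕ n)) *ₗ fold v T (toℕ n)) ⟩
        sumᴹ {N} (λ k → sumᴹ {N} (λ n → (f (toℕ k) * (g ^ₛ toℕ k) (toℕ n)) *ₗ fold v T (toℕ n)))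
          ≈⟨ sumᴹ-cong {N} (λ k → truncated-* N (f (toℕ k)) (g ^ₛ toℕ k) v) ⟩
        sumᴹ {N} (λ k → f (toℕ k) *ₗ truncated N (g ^ₛ toℕ k) v)
          ≈⟨ sumᴹ-cong {N} (λ k → *ₗ-congˡ (≈ᴹ-trans (≈ᴹ-sym (⟦⟧-extend (g ^ₛ toℕ k) v b≤N))
               (⟦⟧-^ₛ g (toℕ k) v))) ⟩
        sumᴹ {N} (λ k → f (toℕ k) *ₗ fold v ⟦ g ⟧ (toℕ k)) ∎

      -- The hypothesis iterates to every power of `T`, so `L` turns `ψ` of `T` into `ψ` of `⟦ φ ⟧`,
      -- which is `t` of `T`. The cut-off `N` covers both `v` and `L v`.
      intertwine-inverse : ∀ {φ ψ} → φ 0 ≈ 0# → ψ ∘ₛ φ ≈ₛ t →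
                           ∀ {L} → IsLinear L → (∀ v → L (T v) ≈ᴹ ⟦ φ ⟧ (L v)) →
                           ∀ v → L (⟦ ψ ⟧ v) ≈ᴹ T (L v)
      intertwine-inverse {φ} {ψ} φ0≈0 ψ∘φ≈t {L} L-linear L-T v = begin
        L (⟦ ψ ⟧ v)
          ≈⟨ cong L-linear (⟦⟧-extend ψ v (ℕₚ.m≤m⊔n (bound′ v) (bound′ (L v)))) ⟩
        L (truncated N ψ v)
          ≈⟨ sum-homo L-linear {N} _ ⟩
        sumᴹ {N} (λ k → L (ψ (toℕ k) *ₗ fold v T (toℕ k)))
          ≈⟨ sumᴹ-cong {N} (λ k → ≈ᴹ-trans (*-homo L-linear _ _) (*ₗ-congˡ (L-Tᵏ (toℕ k)))) ⟩
        sumᴹ {N} (λ k → ψ (toℕ k) *ₗ fold (L v) ⟦ φ ⟧ (toℕ k))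
          ≈⟨ ⟦⟧-∘ₛ ψ φ φ0≈0 (L v) (ℕₚ.m≤n⊔m (bound′ v) (bound′ (L v))) ⟨
        ⟦ ψ ∘ₛ φ ⟧ (L v)
          ≈⟨ truncated-congˡ (bound′ (L v)) ψ∘φ≈t (L v) ⟩
        ⟦ t ⟧ (L v)
          ≈⟨ ⟦t⟧ (L v) ⟩
        T (L v) ∎
        where
        N = bound′ v ℕ.⊔ bound′ (L v)
        L-Tᵏ : ∀ k → L (fold v T k) ≈ᴹ fold (L v) ⟦ φ ⟧ k
        L-Tᵏ zero    = ≈ᴹ-refl
        L-Tᵏ (suc k) = ≈ᴹ-trans (L-T (fold v T k)) (cong (⟦⟧-linear φ) (L-Tᵏ k))

  -- Polynomials as a semimodule over the scalars.

  -- _≈ₚ_ unfolds to a function type, from which Agda cannot infer the polynomials.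
  infix 4 _≐_
  record _≐_ (p q : Poly) : Set ℓ₁ where
    constructor ≐-intro
    field coeffs : p ≈ₚ q
  open _≐_

  polynomials : LeftSemimodule semiring (c ⊔ ℓ₁) ℓ₁
  polynomials = record
    { _≈ᴹ_ = _≐_
    ; _+ᴹ_ = _+ₚ_
    ; _*ₗ_ = _·ₚ_
    ; 0ᴹ   = 0ₚ
    ; isLeftSemimodule = record
      { +ᴹ-isCommutativeMonoid = record
        { isMonoid = record
          { isSemigroup = record
            { isMagma = record
              { isEquivalence = record
                { refl  = ≐-intro λ _ → refl
                ; sym   = λ e → ≐-intro λ n → sym (coeffs e n)
                ; trans = λ e e′ → ≐-intro λ n → trans (coeffs e n) (coeffs e′ n)
                }
              ; ∙-cong = λ e e′ → ≐-intro λ n → +-cong (coeffs e n) (coeffs e′ n)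
              }
            ; assoc = λ _ _ _ → ≐-intro λ _ → +-assoc _ _ _
            }
          ; identity = (λ _ → ≐-intro λ _ → +-identityˡ _) , (λ _ → ≐-intro λ _ → +-identityʳ _)
          }
        ; comm = λ _ _ → ≐-intro λ _ → +-comm _ _
        }
      ; isPreleftSemimodule = record
        { *ₗ-cong      = λ e e′ → ≐-intro λ n → *-cong e (coeffs e′ n)
        ; *ₗ-zeroˡ     = λ _ → ≐-intro λ _ → zeroˡ _
        ; *ₗ-distribʳ  = λ _ _ _ → ≐-intro λ _ → distribʳ _ _ _
        ; *ₗ-identityˡ = λ _ → ≐-intro λ _ → *-identityˡ _
        ; *ₗ-assoc     = λ _ _ _ → ≐-intro λ _ → *-assoc _ _ _
        ; *ₗ-zeroʳ     = λ _ → ≐-intro λ _ → zeroʳ _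
        ; *ₗ-distribˡ  = λ _ _ _ → ≐-intro λ _ → distribˡ _ _ _
        }
      }
    }

  open LeftSemimodule polynomials using (≈ᴹ-trans)
  open Linear polynomials
  open IsLinear

  coeff-sumₚ : ∀ {n} (v : Vector Poly n) k → coeff (sumₚ v) k ≈ sum (λ i → coeff (v i) k)
  coeff-sumₚ {zero}  v k = refl
  coeff-sumₚ {suc n} v k = +-congˡ (coeff-sumₚ (v ∘ Fin.suc) k)

  -- Terms of positive degree contain a factor `0#`. If `bound` is zero the sum is empty, and
  -- `vanishes` gives the coefficient.
  eval-0≈coeff-0 : ∀ p → eval p 0# ≈ coeff p 0
  eval-0≈coeff-0 record { bound = zero ; vanishes = v } = sym (v z≤n)
  eval-0≈coeff-0 record { coeff = p ; bound = suc b } = trans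
    (+-cong (*-identityʳ (p 0)) (sum-ε {b} λ i → trans (*-congˡ (zeroˡ _)) (zeroʳ _)))
    (+-identityʳ _)

  -- Degree-lowering operators.

  VanishesFrom : ℕ → Poly → Set ℓ₁
  VanishesFrom b p = ∀ {n} → b ≤ n → coeff p n ≈ 0#

  -- Phrased through coefficients because the stored `bound` of `f ⟨ D ⟩` at `p` does not drop even
  -- when `f 0 ≈ 0#`: the term of index 0 still contributes `bound p`.
  Lowers : Operator → Set (c ⊔ ℓ₁)
  Lowers T = ∀ {b} p → VanishesFrom (suc b) p → VanishesFrom b (T p)

  fold-lowers : ∀ {T} → Lowers T → ∀ k {b} p → VanishesFrom (k ℕ.+ b) p →
                VanishesFrom b (fold p T k)
  fold-lowers T zero        p v = v
  fold-lowers T (suc k) {b} p v = T _ (fold-lowers T k {suc b} p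
    λ {n} le → v (≡.subst (_≤ n) (ℕₚ.+-suc k b) le))

  -- Each application costs one degree, so `bound p` of them leave no coefficient.
  lowers⇒nilpotent : ∀ {T} → Lowers T → ∀ p {k} → bound p ≤ k → fold p T k ≐ 0ₚ
  lowers⇒nilpotent T p {k} b≤k = ≐-intro λ n → fold-lowers T k {0} p
    (λ k+0≤n → vanishes p (ℕₚ.≤-trans b≤k (ℕₚ.m+n≤o⇒m≤o k k+0≤n))) z≤n

  D-linear : IsLinear D
  D-linear = record
    { cong   = λ e → ≐-intro λ n → *-congˡ (coeffs e (suc n))
    ; +-homo = λ p q → ≐-intro λ n → distribˡ _ _ _
    ; *-homo = λ a p → ≐-intro λ n → x*[y*z]≈y*[x*z] _ a _
    }

  D-lowers : Lowers D
  D-lowers p v b≤n = trans (*-congˡ (v (s≤s b≤n))) (zeroʳ _)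

  -- With `bound` as cut-off, `⟦ f ⟧` unfolds to `f ⟨ D ⟩`, so the general results speak directly
  -- about `θ` and `η`.
  open LocallyNilpotent D D-linear bound (lowers⇒nilpotent D-lowers)
    using (intertwine-inverse) renaming (⟦⟧-extend to ⟨D⟩-extend; ⟦⟧-linear to ⟨D⟩-linear)

  -- The identity term has coefficient zero, and every other term differentiates at least once.
  ⟨D⟩-lowers : ∀ f → f 0 ≈ 0# → Lowers (f ⟨ D ⟩)
  ⟨D⟩-lowers f f0≈0 {b} p v {n} b≤n = trans
    (coeff-sumₚ {bound p} (λ k → f (toℕ k) ·ₚ fold p D (toℕ k)) n)
    (sum-ε {bound p} λ i → term (toℕ i))
    where
    term : ∀ k → f k * coeff (fold p D k) n ≈ 0#
    term zero    = trans (*-congʳ f0≈0) (zeroˡ _)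
    term (suc k) = trans
      (*-congˡ (fold-lowers D-lowers (suc k) {b} p
        (λ le → v (ℕₚ.≤-trans (s≤s (ℕₚ.m≤n+m b k)) le)) b≤n))
      (zeroʳ _)

  -- The map `L` from monomials to poweroids.

  module Transfer (φ ψ : Series) (φ0≈0 : φ 0 ≈ 0#) (ψ∘φ≈t : ψ ∘ₛ φ ≈ₛ t)
                  (x^[_] : ℕ → Poly) (poweroids : IsPoweroids (φ ⟨ D ⟩) x^[_]) where

    open IsPoweroids poweroids

    θ η : Operator
    θ = φ ⟨ D ⟩
    η = ψ ⟨ D ⟩

    θ-linear : IsLinear θ
    θ-linear = ⟨D⟩-linear φ

    open BasisExtension bound (λ i p → coeff p i) (λ i e → coeffs e i)
      (λ _ _ _ → refl) (λ _ _ _ → refl) vanishes x^[_]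
      renaming (total to L; extend to L-extend; total-linear to L-linear)

    L-X^ : ∀ r → L (X^ r) ≐ x^[ r ]
    L-X^ r = sum-kronecker r x^[_]

    coeff-0-L : ∀ p → coeff (L p) 0 ≈ coeff p 0
    coeff-0-L p = begin
      coeff (L p) 0
        -- One extra term guarantees that index 0 is present even if `bound p` is zero.
        ≈⟨ coeffs (L-extend p (ℕₚ.n≤1+n (bound p))) 0 ⟩
      coeff p 0 * coeff x^[ 0 ] 0 + coeff (sumₚ {bound p} tailTerm) 0
        ≈⟨ +-cong (*-congˡ (zeroth 0)) (trans (coeff-sumₚ {bound p} tailTerm 0)
             (sum-ε {bound p} λ i → trans
               (*-congˡ (trans (sym (eval-0≈coeff-0 x^[ suc (toℕ i) ])) (at-0 (toℕ i))))
               (zeroʳ _))) ⟩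
      coeff p 0 * 1# + 0#
        ≈⟨ trans (+-identityʳ _) (*-identityʳ _) ⟩
      coeff p 0 ∎
      where
      open SetoidReasoning setoid
      tailTerm : Vector Poly (bound p)
      tailTerm i = coeff p (suc (toℕ i)) ·ₚ x^[ suc (toℕ i) ]

    -- The recursion `lower` starts at index 1; here `θ` kills constants because `φ` has no constant
    -- term.
    θ-x^[0] : θ x^[ 0 ] ≐ 0ₚ
    θ-x^[0] = ≈ᴹ-trans (cong θ-linear {x^[ 0 ]} {X^ 0} (≐-intro zeroth))
      (≐-intro λ n → ⟨D⟩-lowers φ φ0≈0 (X^ 0) (vanishes (X^ 0)) {n} z≤n)

    L-D : ∀ p → L (D p) ≐ θ (L p)
    L-D = total-shift {D} {θ} θ-linear (λ i → suc i × 1#) (λ _ _ → refl) θ-x^[0]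
      (λ i → ≐-intro (lower i))

    L-η : ∀ p → L (η p) ≐ D (L p)
    L-η = intertwine-inverse {φ} {ψ} φ0≈0 ψ∘φ≈t {L} L-linear L-D

    L-ηᵏ : ∀ r k → L (fold (X^ r) η k) ≐ fold x^[ r ] D k
    L-ηᵏ r zero    = L-X^ r
    L-ηᵏ r (suc k) = ≈ᴹ-trans (L-η (fold (X^ r) η k)) (cong D-linear (L-ηᵏ r k))

    transfer : ψ 0 ≈ 0# → ∀ f r → eval ((f ⟨ D ⟩) x^[ r ]) 0# ≈ eval ((f ⟨ η ⟩) (X^ r)) 0#
    transfer ψ0≈0 f r = begin
      eval ((f ⟨ D ⟩) x^[ r ]) 0#
        ≈⟨ eval-0≈coeff-0 ((f ⟨ D ⟩) x^[ r ]) ⟩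
      coeff ((f ⟨ D ⟩) x^[ r ]) 0
        ≈⟨ coeffs (⟨D⟩-extend f x^[ r ] (ℕₚ.m≤m⊔n (bound x^[ r ]) (suc r))) 0 ⟩
      coeff (sumₚ {N} (λ k → f (toℕ k) ·ₚ fold x^[ r ] D (toℕ k))) 0
        ≈⟨ coeff-sumₚ {N} (λ k → f (toℕ k) ·ₚ fold x^[ r ] D (toℕ k)) 0 ⟩
      sum {N} (λ k → f (toℕ k) * coeff (fold x^[ r ] D (toℕ k)) 0)
        -- Term by term: `L` carries powers of `η` on the monomial to powers of `D` on the poweroid
        -- and keeps the constant coefficient.
        ≈⟨ sum-cong-≋ {N} (λ k → *-congˡ (trans
             (sym (coeffs (L-ηᵏ r (toℕ k)) 0)) (coeff-0-L (fold (X^ r) η (toℕ k))))) ⟩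
      sum {N} (λ k → f (toℕ k) * coeff (fold (X^ r) η (toℕ k)) 0)
        ≈⟨ coeff-sumₚ {N} (λ k → f (toℕ k) ·ₚ fold (X^ r) η (toℕ k)) 0 ⟨
      coeff (sumₚ {N} (λ k → f (toℕ k) ·ₚ fold (X^ r) η (toℕ k))) 0
        ≈⟨ coeffs (⟨η⟩-extend f (X^ r) (ℕₚ.m≤n⊔m (bound x^[ r ]) (suc r))) 0 ⟨
      coeff ((f ⟨ η ⟩) (X^ r)) 0
        ≈⟨ eval-0≈coeff-0 ((f ⟨ η ⟩) (X^ r)) ⟨
      eval ((f ⟨ η ⟩) (X^ r)) 0# ∎
      where
      open SetoidReasoning setoid
      -- `ψ 0 ≈ 0#` makes `η` lower degrees, so a series in `η` may also be extended to the cut-off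
      -- `N`.
      open LocallyNilpotent η (⟨D⟩-linear ψ) bound
        (lowers⇒nilpotent (⟨D⟩-lowers ψ ψ0≈0))
        using () renaming (⟦⟧-extend to ⟨η⟩-extend)
      N = bound x^[ r ] ℕ.⊔ suc r

mainTheorem2 : ∀ {c ℓ₁ ℓ₂} (K : HeytingField c ℓ₁ ℓ₂) → let open Operators K in
    CharacteristicZero →
    (φ ψ : Series) → IsDeltaSeries φ → IsCompositionalInverse φ ψ →
    (x^[_] : ℕ → Poly) → IsPoweroids (φ ⟨ D ⟩) x^[_] →
    (f : Series) (r : ℕ) →
    let η = ψ ⟨ D ⟩ in
    eval ((f ⟨ D ⟩) x^[ r ]) 0# ≈ eval ((f ⟨ η ⟩) (X^ r)) 0#
mainTheorem2 K _ φ ψ δ inv x^[_] poweroids =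
  OverField.Transfer.transfer K φ ψ (IsDeltaSeries.constant≈0 δ)
    (IsCompositionalInverse.inverseˡ inv) x^[_] poweroids
    (IsCompositionalInverse.constant≈0 inv)
  where open Operators K
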